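{- Any deterministic algorithm for triangle membership in the CONGEST$(1)$ model requires $\Omega(\log^* n)$ rounds, even for graphs of maximum degree $2$. That is, there exist constants $c>0$ and $n_0$ such that for every $n\ge n_0$, every deterministic algorithm in the CONGEST$(1)$ model that solves the triangle membership problem on all $n$-node graphs of maximum degree at most $2$ uses at least $c\log^* n$ rounds.
   Context: CONGEST$(B)$ model (with $KT_1$ knowledge): the network is a simple undirected graph on $n$ nodes, each node having a unique ID in $[N]=\{1,\dots,N\}$, where $N\ge n$ is some polynomial in $n$. Initially each node knows its own ID and the IDs of its neighbors (and the global parameters such as $n$, $N$), and nothing else about the graph. Computation proceeds in synchronous rounds; in each round each node sends a message of exactly $B$ bits to each of its neighbors (possibly different messages to different neighbors). The message sent in a round is a function of the initial knowledge of the node and the messages received in previous rounds; local computation is unbounded. After the last round each node produces an output determined by its initial knowledge and all messages it received. An algorithm solves a problem on a class of graphs if it is correct for every graph in the class and every assignment of distinct IDs from $[N]$. CONGEST$(1)$ is the case $B=1$. Triangle membership problem: each node must output whether it is contained in a triangle of the graph. $\log^* n$ is the iterated logarithm: the number of times $\log_2$ must be applied to $n$ until the result is at most $1$. -}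

module Defs where

open import Data.Bool using (Bool; true)
open import Data.Fin using (Fin)
open import Data.Fin.Properties using (any?; _≟_)
open import Data.Fin.Subset using (Subset; _∈_; _∉_; ∣_∣)
open import Data.Fin.Subset.Properties using (_∈?_)
open import Data.Integer using (+_)
open import Data.List using (List; foldr)
open import Data.Maybe using (Maybe; map)
open import Data.Nat using (ℕ; zero; suc; _+_; _^_; _≤_; _<_; z≤n; s≤s)
open import Data.Nat.Induction using (Acc; acc; <-wellFounded)
open import Data.Nat.Logarithm using (⌈log₂_⌉; ⌈log₂⌉-mono-≤; ⌈log₂2^n⌉≡n)
open import Data.Nat.Properties using (≤-refl; ≤-reflexive; ≤-trans; +-mono-≤; m≤m+n)
open import Data.Product using (∃; ∃₂; _×_; _,_; proj₁)
open import Data.Rational as ℚ using (ℚ; 0ℚ)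
open import Data.Vec using (Vec; []; _∷_; tabulate)
open import Function.Bundles using (_↣_; _⇔_; module Injection)
open import Relation.Binary.PropositionalEquality using (_≡_)
open import Relation.Nullary using (Dec; does)
open import Relation.Nullary.Decidable using (_×-dec_; dec⇒maybe)

fromℕ : ℕ → ℚ
fromℕ n = + n ℚ./ 1

-- Coefficients are listed from the constant term upwards.
eval : List ℚ → ℚ → ℚ
eval p x = foldr (λ a r → a ℚ.+ x ℚ.* r) 0ℚ p

IsPolynomial : (ℕ → ℕ) → Set
IsPolynomial f = ∃ λ (p : List ℚ) → ∀ n → fromℕ (f n) ≡ eval p (fromℕ n)

2+n≤2^[1+n] : ∀ n → 2 + n ≤ 2 ^ suc n
2+n≤2^[1+n] zero    = ≤-refl
2+n≤2^[1+n] (suc n) =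
  +-mono-≤ {1} (≤-trans (s≤s z≤n) (2+n≤2^[1+n] n))
               (≤-trans (2+n≤2^[1+n] n) (m≤m+n (2 ^ suc n) 0))

⌈log₂[2+n]⌉<2+n : ∀ n → ⌈log₂ (2 + n) ⌉ < 2 + n
⌈log₂[2+n]⌉<2+n n =
  s≤s (≤-trans (⌈log₂⌉-mono-≤ (2+n≤2^[1+n] n))
               (≤-reflexive (⌈log₂2^n⌉≡n (suc n))))

-- The number of times log₂ must be applied to n until the result is at most 1.
-- Rounding up at every step does not change this number: for real x > 1,
-- log₂ x ≤ k iff x ≤ 2 ^ k iff ⌈ x ⌉ ≤ 2 ^ k for every natural k, so
-- ⌈ log₂ ⌈ x ⌉ ⌉ = ⌈ log₂ x ⌉; and ⌈ x ⌉ ≤ 1 iff x ≤ 1.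
log*-acc : ∀ n → Acc _<_ n → ℕ
log*-acc 0             _        = 0
log*-acc 1             _        = 0
log*-acc (suc (suc n)) (acc rs) =
  suc (log*-acc ⌈log₂ (2 + n) ⌉ (rs (⌈log₂[2+n]⌉<2+n n)))

log* : ℕ → ℕ
log* n = log*-acc n (<-wellFounded n)

record Graph (n : ℕ) : Set where
  field
    neighbourhood : Fin n → Subset n
    symmetric     : ∀ {u v} → u ∈ neighbourhood v → v ∈ neighbourhood u
    irreflexive   : ∀ {u} → u ∉ neighbourhood u

open Graph public

MaxDegree≤ : ∀ {n} → ℕ → Graph n → Set
MaxDegree≤ Δ G = ∀ u → ∣ neighbourhood G u ∣ ≤ Δ

InTriangle : ∀ {n} → Graph n → Fin n → Set
InTriangle G u = ∃₂ λ v w →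
  v ∈ neighbourhood G u × w ∈ neighbourhood G u × w ∈ neighbourhood G v

-- The ID space {1, …, N} is represented by Fin N.
record Knowledge (N : ℕ) : Set where
  constructor knowledge
  field
    ownID        : Fin N
    neighbourIDs : Subset N

Message : ℕ → Set
Message B = Vec Bool B

-- What a node receives in one round: entry j is the message from the neighbour
-- with ID j, and nothing if there is no such neighbour.
Inbox : ℕ → ℕ → Set
Inbox N B = Vec (Maybe (Message B)) N

-- Histories list the most recent round first.  Knowledge and histories are
-- vectors rather than functions, so that an algorithm cannot distinguish
-- between extensionally equal views.  The last argument of send is the ID of
-- the recipient; values at IDs that are not neighbours are never used.
record Algorithm (N B : ℕ) : Set where
  field
    rounds : ℕ
    send   : ∀ {t} → Knowledge N → Vec (Inbox N B) t → Fin N → Message B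
    output : Knowledge N → Vec (Inbox N B) rounds → Bool

open Algorithm public

module Execution {n N B} (A : Algorithm N B) (G : Graph n) (ids : Fin n ↣ Fin N) where

  open Injection ids using () renaming (to to idOf)

  neighbourWithID : ∀ u j → Dec (∃ λ v → v ∈ neighbourhood G u × idOf v ≡ j)
  neighbourWithID u j = any? λ v → (v ∈? neighbourhood G u) ×-dec (idOf v ≟ j)

  initial : Fin n → Knowledge N
  initial u = knowledge (idOf u) (tabulate λ j → does (neighbourWithID u j))

  history : ∀ t → Fin n → Vec (Inbox N B) t
  history zero    u = []
  history (suc t) u = tabulate received ∷ history t u
    where
    message : Fin n → Message B
    message v = send A (initial v) (history t v) (idOf u)

    received : Fin N → Maybe (Message B)
    received j = map (λ found → message (proj₁ found)) (dec⇒maybe (neighbourWithID u j))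

  decision : Fin n → Bool
  decision u = output A (initial u) (history (rounds A) u)

SolvesTriangleMembershipOn : ∀ {n N B} → (Graph n → Set) → Algorithm N B → Set
SolvesTriangleMembershipOn {n} {N} C A =
  ∀ (G : Graph n) → C G → (ids : Fin n ↣ Fin N) → ∀ u →
  Execution.decision A G ids u ≡ true ⇔ InTriangle G u

{-# OPTIONS --safe #-}
module Submission where

open import Defs
open import Data.Bool using (true; false)
open import Data.Fin as Fin using (Fin; zero; suc; toℕ; fromℕ<; inject≤; combine; remQuot; funToFin; finToFun)
open import Data.Fin.Patterns
open import Data.Fin.Properties using (_≟_; any?; all?; pigeonhole; <⇒≢; inject≤-injective; combine-injective; combine-remQuot; finToFun-funToFin; toℕ-fromℕ<; 2↔Bool)
open import Data.Fin.Subset using (Subset; inside; outside; _∈_; ⁅_⁆; _∪_; ⊥; ∣_∣)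
open import Data.Fin.Subset.Properties using (∉⊥; ∣⊥∣≡0; ∣⁅x⁆∣≡1; x∈⁅x⁆; x∈⁅y⁆⇒x≡y; x∈p∪q⁺; x∈p∪q⁻; _∈?_)
open import Data.Integer as ℤ using ()
open import Data.Integer.Properties as ℤ using ()
open import Data.Maybe using (map)
open import Data.Maybe.Properties using (map-cong)
open import Data.Nat using (ℕ; zero; suc; _+_; _*_; _^_; _≤_; _<_; z≤n; s≤s)
open import Data.Nat.Induction using (<-wellFounded; acc)
open import Data.Nat.Logarithm using (⌈log₂_⌉; ⌈log₂⌉-mono-≤; ⌈log₂2^n⌉≡n)
open import Data.Nat.Properties hiding (_≟_; <⇒≢)
open import Data.Nat.Solver using (module +-*-Solver)
open import Data.Product using (∃; ∃₂; _×_; _,_; proj₁; proj₂)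
open import Data.Rational as ℚ using (ℚ; 0ℚ)
open import Data.Rational.Properties as ℚ using ()
open import Data.Rational.Unnormalised as ℚᵘ using (mkℚᵘ; *≤*)
open import Data.Rational.Unnormalised.Properties as ℚᵘ using ()
open import Data.Sum as Sum using (_⊎_; inj₁; inj₂)
open import Data.Vec using (Vec; []; _∷_; head; lookup; zipWith; replicate; tabulate)
open import Data.Vec.Properties using (tabulate-cong; lookup-zipWith)
open import Function using (_∘_; _$_; Injective)
open import Function.Bundles using (_↣_; mk↣; module Injection; module Inverse; module Equivalence)
open import Relation.Binary.PropositionalEquality
open import Relation.Nullary using (Dec; yes; no; does; ¬_; contradiction)
open import Relation.Nullary.Decidable using (_×-dec_; dec⇒maybe; from-yes)

-- Take three disjoint classes of p nodes and colour each triple with one node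
-- from every class by its transcript, the messages sent in R rounds when the
-- triple forms a triangle.  At most 2 ^ (9 R) colours occur, so if p is at least
-- 2 ^ (27 (9 R + 1)), three applications of the pigeonhole principle give
-- u₀ ≠ v₀, u₁ ≠ v₁, u₂ ≠ v₂ such that the eight triples choosing one node from
-- each pair have the same transcript.  Any three consecutive nodes of the hexagon
-- u₀ u₁ u₂ v₀ v₁ v₂ form such a triple, so by induction on the round its middle
-- node sends and receives the same messages as in the triangle on that triple, and
-- wrongly claims to be in a triangle.  Hence n < 2 ^ (29 + 243 R), which is even
-- stronger than needed, since log* n ≤ 1 + ⌈log₂ n⌉.

∣p∪q∣≤∣p∣+∣q∣ : ∀ {n} (p q : Subset n) → ∣ p ∪ q ∣ ≤ ∣ p ∣ + ∣ q ∣
∣p∪q∣≤∣p∣+∣q∣ []            []            = z≤n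
∣p∪q∣≤∣p∣+∣q∣ (inside  ∷ p) (inside  ∷ q) =
  s≤s (≤-trans (∣p∪q∣≤∣p∣+∣q∣ p q) (+-monoʳ-≤ ∣ p ∣ (n≤1+n ∣ q ∣)))
∣p∪q∣≤∣p∣+∣q∣ (inside  ∷ p) (outside ∷ q) = s≤s (∣p∪q∣≤∣p∣+∣q∣ p q)
∣p∪q∣≤∣p∣+∣q∣ (outside ∷ p) (inside  ∷ q) =
  ≤-trans (s≤s (∣p∪q∣≤∣p∣+∣q∣ p q)) (≤-reflexive (sym (+-suc ∣ p ∣ ∣ q ∣)))
∣p∪q∣≤∣p∣+∣q∣ (outside ∷ p) (outside ∷ q) = ∣p∪q∣≤∣p∣+∣q∣ p q

-- Cycles

record CyclicOrder (k : ℕ) : Set where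
  field
    next prev : Fin k → Fin k
    prev-next : ∀ i → prev (next i) ≡ i
    next-prev : ∀ i → next (prev i) ≡ i
    next≢     : ∀ i → next i ≢ i

  Adjacent : Fin k → Fin k → Set
  Adjacent i j = j ≡ prev i ⊎ j ≡ next i

  adjacent-sym : ∀ {i j} → Adjacent i j → Adjacent j i
  adjacent-sym (inj₁ refl) = inj₂ (sym (next-prev _))
  adjacent-sym (inj₂ refl) = inj₁ (sym (prev-next _))

  adjacent-irrefl : ∀ {i} → ¬ Adjacent i i
  adjacent-irrefl (inj₁ i≡prev) = next≢ _ (trans (cong next i≡prev) (next-prev _))
  adjacent-irrefl (inj₂ i≡next) = next≢ _ (sym i≡next)

module Cycle {k n} (C : CyclicOrder k) (nodes : Fin k ↣ Fin n) where

  open CyclicOrder C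
  open Injection nodes using (injective) renaming (to to node)

  beside : Fin k → Subset n
  beside i = ⁅ node (prev i) ⁆ ∪ ⁅ node (next i) ⁆

  onCycle? : ∀ u → Dec (∃ λ i → node i ≡ u)
  onCycle? u = any? λ i → node i ≟ u

  -- Nodes off the cycle are isolated, which turns a short cycle into a graph on all `n` nodes.
  besideIfOnCycle : ∀ {u} → Dec (∃ λ i → node i ≡ u) → Subset n
  besideIfOnCycle (yes (i , _)) = beside i
  besideIfOnCycle (no  _)       = ⊥

  around : Fin n → Subset n
  around u = besideIfOnCycle (onCycle? u)

  around-node : ∀ i → around (node i) ≡ beside i
  around-node i with onCycle? (node i)
  ... | yes (j , eq) = cong beside (injective eq)
  ... | no  off      = contradiction (i , refl) off

  ∈-around⁺ : ∀ {i j} → Adjacent i j → node j ∈ around (node i)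
  ∈-around⁺ {i} adj = subst (_ ∈_) (sym (around-node i)) (x∈p∪q⁺ (Sum.map at at adj))
    where
    at : ∀ {j l} → j ≡ l → node j ∈ ⁅ node l ⁆
    at refl = x∈⁅x⁆ _

  ∈-around⁻ : ∀ {u v} → u ∈ around v → ∃₂ λ i j → node i ≡ v × node j ≡ u × Adjacent i j
  ∈-around⁻ {u} {v} u∈v with onCycle? v
  ... | no  _        = contradiction u∈v ∉⊥
  ... | yes (i , eq) with x∈p∪q⁻ ⁅ node (prev i) ⁆ ⁅ node (next i) ⁆ u∈v
  ...   | inj₁ u∈prev = i , prev i , eq , sym (x∈⁅y⁆⇒x≡y _ u∈prev) , inj₁ refl
  ...   | inj₂ u∈next = i , next i , eq , sym (x∈⁅y⁆⇒x≡y _ u∈next) , inj₂ refl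

  ∈-around-node⁻ : ∀ {u i} → u ∈ around (node i) → ∃ λ j → node j ≡ u × Adjacent i j
  ∈-around-node⁻ u∈i with ∈-around⁻ u∈i
  ... | i′ , j , eq , node-j , adj = j , node-j , subst (λ l → Adjacent l j) (injective eq) adj

  cycle : Graph n
  cycle = record
    { neighbourhood = around
    ; symmetric     = λ u∈v → reversed (∈-around⁻ u∈v)
    ; irreflexive   = λ u∈u → no-loop (∈-around⁻ u∈u)
    }
    where
    reversed : ∀ {u v} → (∃₂ λ i j → node i ≡ v × node j ≡ u × Adjacent i j) → v ∈ around u
    reversed (i , j , refl , refl , adj) = ∈-around⁺ (adjacent-sym adj)

    no-loop : ∀ {u} → ¬ (∃₂ λ i j → node i ≡ u × node j ≡ u × Adjacent i j)
    no-loop (i , j , refl , eq , adj) =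
      adjacent-irrefl (subst (Adjacent i) (injective eq) adj)

  cycle-maxDegree : MaxDegree≤ 2 cycle
  cycle-maxDegree u with onCycle? u
  ... | no  _       = ≤-trans (≤-reflexive (∣⊥∣≡0 n)) z≤n
  ... | yes (i , _) = begin
    ∣ beside i ∣                                     ≤⟨ ∣p∪q∣≤∣p∣+∣q∣ ⁅ node (prev i) ⁆ _ ⟩
    ∣ ⁅ node (prev i) ⁆ ∣ + ∣ ⁅ node (next i) ⁆ ∣     ≡⟨ cong₂ _+_ (∣⁅x⁆∣≡1 (node (prev i))) (∣⁅x⁆∣≡1 (node (next i))) ⟩
    2                                                ∎
    where open ≤-Reasoning

  inTriangle⁺ : ∀ {i j l} → Adjacent i j → Adjacent i l → Adjacent j l → InTriangle cycle (node i)
  inTriangle⁺ ij il jl = _ , _ , ∈-around⁺ ij , ∈-around⁺ il , ∈-around⁺ jl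

  inTriangle⁻ : ∀ {i} → InTriangle cycle (node i) →
    ∃₂ λ j l → Adjacent i j × Adjacent i l × Adjacent j l
  inTriangle⁻ (v , w , v∈u , w∈u , w∈v) with ∈-around-node⁻ v∈u | ∈-around-node⁻ w∈u
  ... | j , refl , ij | l , refl , il with ∈-around-node⁻ w∈v
  ...   | l′ , eq , jl = j , l , ij , il , subst (Adjacent j) (injective eq) jl

triangular : CyclicOrder 3
triangular = record
  { next      = next
  ; prev      = prev
  ; prev-next = from-yes (all? λ i → prev (next i) ≟ i)
  ; next-prev = from-yes (all? λ i → next (prev i) ≟ i)
  ; next≢     = λ { 0F () ; 1F () ; 2F () }
  }
  where
  next prev : Fin 3 → Fin 3
  next = lookup (1F ∷ 2F ∷ 0F ∷ [])
  prev = lookup (2F ∷ 0F ∷ 1F ∷ [])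

hexagonal : CyclicOrder 6
hexagonal = record
  { next      = next
  ; prev      = prev
  ; prev-next = from-yes (all? λ i → prev (next i) ≟ i)
  ; next-prev = from-yes (all? λ i → next (prev i) ≟ i)
  ; next≢     = λ { 0F () ; 1F () ; 2F () ; 3F () ; 4F () ; 5F () }
  }
  where
  next prev : Fin 6 → Fin 6
  next = lookup (1F ∷ 2F ∷ 3F ∷ 4F ∷ 5F ∷ 0F ∷ [])
  prev = lookup (5F ∷ 0F ∷ 1F ∷ 2F ∷ 3F ∷ 4F ∷ [])

module Triangle = CyclicOrder triangular
module Hexagon  = CyclicOrder hexagonal

triangle-inTriangle : ∀ {n} (nodes : Fin 3 ↣ Fin n) r →
  InTriangle (Cycle.cycle triangular nodes) (Injection.to nodes r)
-- The neighbours `prev r` and `next r` are adjacent because one step forward is two steps back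
-- modulo 3.
triangle-inTriangle nodes r = inTriangle⁺ (inj₁ refl) (inj₂ refl) (inj₁ (next≡prev² r))
  where
  open Cycle triangular nodes
  next≡prev² : ∀ r → Triangle.next r ≡ Triangle.prev (Triangle.prev r)
  next≡prev² = from-yes (all? λ r → Triangle.next r ≟ Triangle.prev (Triangle.prev r))

hexagon-¬inTriangle : ∀ {n} (nodes : Fin 6 ↣ Fin n) →
  ¬ InTriangle (Cycle.cycle hexagonal nodes) (Injection.to nodes 0F)
hexagon-¬inTriangle nodes tri with Cycle.inTriangle⁻ hexagonal nodes tri
-- Adjacency in the hexagon flips parity, and both neighbours of `0F` are odd: each case would
-- equate `5F` or `1F` with an even position.
... | _ , _ , inj₁ refl , inj₁ refl , inj₁ ()
... | _ , _ , inj₁ refl , inj₁ refl , inj₂ ()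
... | _ , _ , inj₁ refl , inj₂ refl , inj₁ ()
... | _ , _ , inj₁ refl , inj₂ refl , inj₂ ()
... | _ , _ , inj₂ refl , inj₁ refl , inj₁ ()
... | _ , _ , inj₂ refl , inj₁ refl , inj₂ ()
... | _ , _ , inj₂ refl , inj₂ refl , inj₁ ()
... | _ , _ , inj₂ refl , inj₂ refl , inj₂ ()

-- Fooling views

module _ {n N B} (A : Algorithm N B) (ids : Fin n ↣ Fin N) where

  open Injection ids using () renaming (to to idOf)
  open Execution {n} A

  sent : Graph n → ℕ → Fin n → Fin n → Message B
  sent G t v u = send A (initial G ids v) (history G ids t v) (idOf u)

  -- This is `neighbourWithID` with the neighbourhood as a variable, so that equal neighbourhoods in
  -- two graphs can be identified by matching on `refl`.
  neighbourIn? : ∀ S j → Dec (∃ λ v → v ∈ S × idOf v ≡ j)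
  neighbourIn? S j = any? λ v → (v ∈? S) ×-dec (idOf v ≟ j)

  initial-cong : ∀ G H {u} → neighbourhood G u ≡ neighbourhood H u → initial G ids u ≡ initial H ids u
  initial-cong G H {u} = cong λ S → knowledge (idOf u) (tabulate λ j → does (neighbourIn? S j))

  history-cong : ∀ G H {t u} → neighbourhood G u ≡ neighbourhood H u →
    history G ids t u ≡ history H ids t u →
    (∀ v → v ∈ neighbourhood G u → sent G t v u ≡ sent H t v u) →
    history G ids (suc t) u ≡ history H ids (suc t) u
  history-cong G H {t} {u} same past messages =
    cong₂ _∷_ (tabulate-cong (λ j → received same j messages)) past
    where
    received : ∀ {S S′} → S ≡ S′ → ∀ j → (∀ v → v ∈ S → sent G t v u ≡ sent H t v u) →
      map (λ found → sent G t (proj₁ found) u) (dec⇒maybe (neighbourIn? S j)) ≡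
      map (λ found → sent H t (proj₁ found) u) (dec⇒maybe (neighbourIn? S′ j))
    received {S} refl j eqs =
      map-cong (λ { (v , v∈S , _) → eqs v v∈S }) (dec⇒maybe (neighbourIn? S j))

  -- It suffices that the messages on the edge from v to u agree in the graphs
  -- that v and u believe to be in: by induction v acts in G as it would there.
  module _ {I : Set} (G : Graph n) (node : I → Fin n) (believed : I → Graph n)
    (same-neighbourhood : ∀ i → neighbourhood G (node i) ≡ neighbourhood (believed i) (node i))
    (agree : ∀ i v → v ∈ neighbourhood G (node i) → ∃ λ j → node j ≡ v ×
      (∀ t → t < rounds A → sent (believed j) t v (node i) ≡ sent (believed i) t v (node i)))
    where

    -- The induction treats all `i` at once, since round `t` at `node i` involves the history of a
    -- neighbour `node j`. The bound on `t` is carried along because `agree` only covers rounds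
    -- before `rounds A`.
    fooled-history : ∀ t → t ≤ rounds A → ∀ i →
      history G ids t (node i) ≡ history (believed i) ids t (node i)
    fooled-history zero    _   i = refl
    fooled-history (suc t) t<R i =
      history-cong G (believed i) (same-neighbourhood i) (fooled-history t (<⇒≤ t<R) i) messages
      where
      messages : ∀ v → v ∈ neighbourhood G (node i) →
        sent G t v (node i) ≡ sent (believed i) t v (node i)
      messages v v∈ with agree i v v∈
      ... | j , refl , eq =
        trans (cong₂ (λ k h → send A k h (idOf (node i)))
                     (initial-cong G (believed j) (same-neighbourhood j))
                     (fooled-history t (<⇒≤ t<R) j))
              (eq t t<R)

    fooled-decision : ∀ i → decision G ids (node i) ≡ decision (believed i) ids (node i)
    fooled-decision i =
      cong₂ (output A) (initial-cong G (believed i) (same-neighbourhood i))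
                       (fooled-history (rounds A) ≤-refl i)

-- Monochromatic boxes

module Twins {p d k : ℕ} (q : ℕ) (k<q : k < q) (q≤p : q ≤ p) (f : Vec (Fin p) (suc d) → Fin k) where

  -- Only `q` values compete for the first coordinate, so the number of pair colours depends on `k`
  -- and `q` but not on `p`. Pairs from all of `Fin p` would give too many colours for the
  -- pigeonhole principle on the next coordinate.
  candidate : Fin q → Fin p
  candidate i = inject≤ i q≤p

  twins : ∀ v → ∃₂ λ i j → i Fin.< j × f (candidate i ∷ v) ≡ f (candidate j ∷ v)
  twins v = pigeonhole k<q (λ i → f (candidate i ∷ v))

  twin : Vec (Fin p) d → Fin 2 → Fin q
  twin v 0F = proj₁ (twins v)
  twin v 1F = proj₁ (proj₂ (twins v))

  twin-injective : ∀ v → Injective _≡_ _≡_ (twin v)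
  twin-injective v {0F} {0F} _  = refl
  twin-injective v {0F} {1F} eq = contradiction eq (<⇒≢ (proj₁ (proj₂ (proj₂ (twins v)))))
  twin-injective v {1F} {0F} eq = contradiction (sym eq) (<⇒≢ (proj₁ (proj₂ (proj₂ (twins v)))))
  twin-injective v {1F} {1F} _  = refl

  twin-colour : ∀ v s → f (candidate (twin v s) ∷ v) ≡ f (candidate (twin v 0F) ∷ v)
  twin-colour v 0F = refl
  twin-colour v 1F = sym (proj₂ (proj₂ (proj₂ (twins v))))

  pairColour : Vec (Fin p) d → Fin (q * q * k)
  pairColour v = combine (combine (twin v 0F) (twin v 1F)) (f (candidate (twin v 0F) ∷ v))

  pairColour-twin : ∀ {v w} → pairColour v ≡ pairColour w → ∀ s → twin v s ≡ twin w s
  pairColour-twin {v} {w} eq s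
    with combine-injective (twin v 0F) (twin v 1F) (twin w 0F) (twin w 1F)
           (proj₁ (combine-injective (combine (twin v 0F) (twin v 1F)) _ (combine (twin w 0F) (twin w 1F)) _ eq))
  pairColour-twin eq 0F | eq₀ , _ = eq₀
  pairColour-twin eq 1F | _ , eq₁ = eq₁

  -- `pairColour` stores the colour seen with the first twin; `twin-colour` transfers it to the
  -- second, so the sides `s` and `s′` may differ.
  pairColour-colour : ∀ {v w} → pairColour v ≡ pairColour w → ∀ s s′ →
    f (candidate (twin v s) ∷ v) ≡ f (candidate (twin w s′) ∷ w)
  pairColour-colour {v} {w} eq s s′ =
    trans (twin-colour v s)
      (trans (proj₂ (combine-injective (combine (twin v 0F) (twin v 1F)) _ (combine (twin w 0F) (twin w 1F)) _ eq))
             (sym (twin-colour w s′)))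

corner : ∀ {p d} → Vec (Fin 2 → Fin p) d → Vec (Fin 2) d → Vec (Fin p) d
corner = zipWith _$_

-- A tail of d coordinates is coloured by two first coordinates that the colouring
-- f does not distinguish in front of it, together with their common colour.
monochromatic-box : ∀ d {m k p} → k ≤ 2 ^ m → 2 ^ (3 ^ d * suc m) ≤ p →
  (f : Vec (Fin p) d → Fin k) →
  ∃ λ (x : Vec (Fin 2 → Fin p) d) →
    (∀ r → Injective _≡_ _≡_ (lookup x r)) × (∀ s s′ → f (corner x s) ≡ f (corner x s′))
monochromatic-box zero    _     _   f = [] , (λ ()) , λ { [] [] → refl }
monochromatic-box (suc d) {m} {k} {p} k≤2^m big f = extend (monochromatic-box d colours bigger pairColour)
  where
  -- A power of two that exceeds `k`, so that the colour count below is again bounded by a power of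
  -- two.
  q : ℕ
  q = 2 ^ suc m

  k<q : k < q
  k<q = ≤-<-trans k≤2^m (^-monoʳ-< 2 (s≤s (s≤s z≤n)) (n<1+n m))

  q≤p : q ≤ p
  q≤p = ≤-trans (^-monoʳ-≤ 2 (m≤n*m (suc m) (3 ^ suc d) {{m^n≢0 3 (suc d)}})) big

  open Twins q k<q q≤p f

  colours : q * q * k ≤ 2 ^ (suc m + suc m + m)
  colours = begin
    q * q * k                 ≤⟨ *-monoʳ-≤ (q * q) k≤2^m ⟩
    q * q * 2 ^ m             ≡⟨ cong (_* 2 ^ m) (sym (^-distribˡ-+-* 2 (suc m) (suc m))) ⟩
    2 ^ (suc m + suc m) * 2 ^ m ≡⟨ sym (^-distribˡ-+-* 2 (suc m + suc m) m) ⟩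
    2 ^ (suc m + suc m + m)   ∎
    where open ≤-Reasoning

  -- The new exponent `3m + 2` has successor `3 (m + 1)`: each coordinate triples `suc m`, whence
  -- the threshold `3 ^ d * suc m`.
  exponent : 3 ^ d * suc (suc m + suc m + m) ≡ 3 ^ suc d * suc m
  exponent = solve 2
    (λ a m → a :* (con 1 :+ ((con 1 :+ m) :+ (con 1 :+ m) :+ m)) := con 3 :* a :* (con 1 :+ m))
    refl (3 ^ d) m
    where open +-*-Solver

  bigger : 2 ^ (3 ^ d * suc (suc m + suc m + m)) ≤ p
  bigger = subst (λ e → 2 ^ e ≤ p) (sym exponent) big

  extend : (∃ λ (x : Vec (Fin 2 → Fin p) d) → (∀ r → Injective _≡_ _≡_ (lookup x r)) ×
                    (∀ s s′ → pairColour (corner x s) ≡ pairColour (corner x s′))) →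
    ∃ λ (x : Vec (Fin 2 → Fin p) (suc d)) → (∀ r → Injective _≡_ _≡_ (lookup x r)) ×
      (∀ s s′ → f (corner x s) ≡ f (corner x s′))
  extend (x , injective , same) = x₀ ∷ x , injective′ , same′
    where
    -- An arbitrary corner: all corners of `x` have the same pair colour, hence the same twins, so
    -- the pair found here serves them all.
    v₀ : Vec (Fin p) d
    v₀ = corner x (replicate d 0F)

    x₀ : Fin 2 → Fin p
    x₀ = candidate ∘ twin v₀

    injective′ : ∀ r → Injective _≡_ _≡_ (lookup (x₀ ∷ x) r)
    injective′ zero    eq = twin-injective v₀ (inject≤-injective q≤p q≤p _ _ eq)
    injective′ (suc r) eq = injective r eq

    colour-x₀ : ∀ s v → f (x₀ s ∷ corner x v) ≡ f (candidate (twin (corner x v) s) ∷ corner x v)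
    colour-x₀ s v = cong (λ i → f (candidate i ∷ corner x v))
                         (pairColour-twin (same (replicate d 0F) v) s)

    same′ : ∀ s s′ → f (corner (x₀ ∷ x) s) ≡ f (corner (x₀ ∷ x) s′)
    same′ (s ∷ v) (s′ ∷ v′) =
      trans (colour-x₀ s v)
        (trans (pairColour-colour (same v v′) s s′) (sym (colour-x₀ s′ v′)))

-- Hexagons that look like triangles

funToFin-injective : ∀ {m n} {f g : Fin m → Fin n} → funToFin f ≡ funToFin g → f ≗ g
funToFin-injective {f = f} {g} eq i =
  trans (sym (finToFun-funToFin f i)) (trans (cong (λ c → finToFun c i) eq) (finToFun-funToFin g i))

-- Turns a whole table into one colour, as the pigeonhole principle requires.
encode : ∀ {k l m n} → (Fin k → Fin l → Fin m → Fin n) → Fin (((n ^ m) ^ l) ^ k)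
encode f = funToFin λ i → funToFin λ j → funToFin (f i j)

encode-injective : ∀ {k l m n} (f g : Fin k → Fin l → Fin m → Fin n) →
  encode f ≡ encode g → ∀ i j → f i j ≗ g i j
encode-injective {k} {l} {m} {n} _ _ eq i j = funToFin-injective {m} {n}
  (funToFin-injective {l} {n ^ m} (funToFin-injective {k} {(n ^ m) ^ l} eq i) j)

bit : Message 1 → Fin 2
bit = Inverse.from 2↔Bool ∘ head

bit-injective : Injective _≡_ _≡_ bit
bit-injective {false ∷ []} {false ∷ []} _ = refl
bit-injective {true  ∷ []} {true  ∷ []} _ = refl

module _ {n N p : ℕ} (A : Algorithm N 1) (n≤N : n ≤ N) (3p≤n : 3 * p ≤ n) where

  ids : Fin n ↣ Fin N
  ids = mk↣ {to = λ u → inject≤ u n≤N} (inject≤-injective n≤N n≤N _ _)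

  -- The three classes are consecutive blocks of `p` nodes.
  place : Fin 3 → Fin p → Fin n
  place r a = inject≤ (combine r a) 3p≤n

  place-injective : ∀ {r r′ a a′} → place r a ≡ place r′ a′ → r ≡ r′ × a ≡ a′
  place-injective eq = combine-injective _ _ _ _ (inject≤-injective 3p≤n 3p≤n _ _ eq)

  triangleNodes : Vec (Fin p) 3 → Fin 3 ↣ Fin n
  triangleNodes v = mk↣ {to = λ r → place r (lookup v r)} (proj₁ ∘ place-injective)

  triangle : Vec (Fin p) 3 → Graph n
  triangle v = Cycle.cycle triangular (triangleNodes v)

  sentInTriangle : Vec (Fin p) 3 → ℕ → Fin 3 → Fin 3 → Message 1
  sentInTriangle v t r r′ = sent A ids (triangle v) t (place r (lookup v r)) (place r′ (lookup v r′))

  -- All nine ordered pairs of roles are recorded, the diagonal included, which gives the 9 bits per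
  -- round.
  bits : Vec (Fin p) 3 → Fin (rounds A) → Fin 3 → Fin 3 → Fin 2
  bits v t r r′ = bit (sentInTriangle v (toℕ t) r r′)

  transcript : Vec (Fin p) 3 → Fin (((2 ^ 3) ^ 3) ^ rounds A)
  transcript v = encode (bits v)

  transcript-sent : ∀ v w → transcript v ≡ transcript w → ∀ t → t < rounds A →
    ∀ r r′ → sentInTriangle v t r r′ ≡ sentInTriangle w t r r′
  transcript-sent v w eq t t<R r r′ =
    subst (λ t → sentInTriangle v t r r′ ≡ sentInTriangle w t r r′) (toℕ-fromℕ< t<R)
      (bit-injective (encode-injective (bits v) (bits w) eq (fromℕ< t<R) r r′))

  module FoolingHexagon (x : Vec (Fin 2 → Fin p) 3) (x-injective : ∀ r → Injective _≡_ _≡_ (lookup x r))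
    (same : ∀ s s′ → transcript (corner x s) ≡ transcript (corner x s′)) where

    -- Quotient and remainder by 3: the positions are u₀ u₁ u₂ v₀ v₁ v₂, so opposite nodes share a
    -- role and three consecutive nodes have distinct roles.
    side : Fin 6 → Fin 2
    side i = proj₁ (remQuot {2} 3 i)

    role : Fin 6 → Fin 3
    role i = proj₂ (remQuot {2} 3 i)

    hexagonNode : Fin 6 → Fin n
    hexagonNode i = place (role i) (lookup x (role i) (side i))

    side-role-injective : ∀ {i j} → side i ≡ side j → role i ≡ role j → i ≡ j
    side-role-injective {i} {j} side≡ role≡ =
      trans (sym (combine-remQuot {2} 3 i)) (trans (cong₂ combine side≡ role≡) (combine-remQuot {2} 3 j))

    hexagonNode-injective : Injective _≡_ _≡_ hexagonNode
    hexagonNode-injective {i} {j} eq with place-injective eq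
    ... | role≡ , x≡ = side-role-injective
      (x-injective (role j) (trans (cong (λ r → lookup x r (side i)) (sym role≡)) x≡)) role≡

    hexagonNodes : Fin 6 ↣ Fin n
    hexagonNodes = mk↣ hexagonNode-injective

    open Cycle hexagonal hexagonNodes using (beside; around-node; ∈-around-node⁻)
      renaming (cycle to hexagon; cycle-maxDegree to hexagon-maxDegree)

    -- The sides of the three consecutive nodes with node i in the middle, listed by role.
    view : Fin 6 → Vec (Fin 2) 3
    view = lookup
      ( (0F ∷ 0F ∷ 1F ∷ [])
      ∷ (0F ∷ 0F ∷ 0F ∷ [])
      ∷ (1F ∷ 0F ∷ 0F ∷ [])
      ∷ (1F ∷ 1F ∷ 0F ∷ [])
      ∷ (1F ∷ 1F ∷ 1F ∷ [])
      ∷ (0F ∷ 1F ∷ 1F ∷ [])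
      ∷ [] )

    Sees : Fin 6 → Fin 6 → Set
    Sees i j = lookup (view i) (role j) ≡ side j

    sees-self : ∀ i → Sees i i
    sees-self = from-yes (all? λ i → lookup (view i) (role i) ≟ side i)

    sees-prev : ∀ i → Sees i (Hexagon.prev i)
    sees-prev = from-yes (all? λ i → lookup (view i) (role (Hexagon.prev i)) ≟ side (Hexagon.prev i))

    sees-next : ∀ i → Sees i (Hexagon.next i)
    sees-next = from-yes (all? λ i → lookup (view i) (role (Hexagon.next i)) ≟ side (Hexagon.next i))

    sees-adjacent : ∀ i {j} → Hexagon.Adjacent i j → Sees i j
    sees-adjacent i (inj₁ refl) = sees-prev i
    sees-adjacent i (inj₂ refl) = sees-next i

    role-prev : ∀ i → role (Hexagon.prev i) ≡ Triangle.prev (role i)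
    role-prev = from-yes (all? λ i → role (Hexagon.prev i) ≟ Triangle.prev (role i))

    role-next : ∀ i → role (Hexagon.next i) ≡ Triangle.next (role i)
    role-next = from-yes (all? λ i → role (Hexagon.next i) ≟ Triangle.next (role i))

    viewNode : Fin 6 → Fin 3 → Fin n
    viewNode i = Injection.to (triangleNodes (corner x (view i)))

    believed : Fin 6 → Graph n
    believed i = triangle (corner x (view i))

    viewNode-sees : ∀ i j → Sees i j → viewNode i (role j) ≡ hexagonNode j
    viewNode-sees i j sees = cong (place (role j))
      (trans (lookup-zipWith _$_ (role j) x (view i)) (cong (lookup x (role j)) sees))

    -- The map `role` commutes with `prev` and `next`, so the two unions of singletons agree operand
    -- by operand.
    same-neighbourhood : ∀ i →
      neighbourhood hexagon (hexagonNode i) ≡ neighbourhood (believed i) (hexagonNode i)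
    same-neighbourhood i = begin
      neighbourhood hexagon (hexagonNode i)
        ≡⟨ around-node i ⟩
      beside i
        ≡⟨ cong₂ (λ u v → ⁅ u ⁆ ∪ ⁅ v ⁆)
             (trans (sym (viewNode-sees i (Hexagon.prev i) (sees-prev i))) (cong (viewNode i) (role-prev i)))
             (trans (sym (viewNode-sees i (Hexagon.next i) (sees-next i))) (cong (viewNode i) (role-next i))) ⟩
      Cycle.beside triangular (triangleNodes (corner x (view i))) (role i)
        ≡⟨ Cycle.around-node triangular (triangleNodes (corner x (view i))) (role i) ⟨
      neighbourhood (believed i) (viewNode i (role i))
        ≡⟨ cong (neighbourhood (believed i)) (viewNode-sees i i (sees-self i)) ⟩
      neighbourhood (believed i) (hexagonNode i) ∎
      where open ≡-Reasoning

    sent-view : ∀ i j l → Sees i j → Sees i l → ∀ t →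
      sentInTriangle (corner x (view i)) t (role j) (role l) ≡
      sent A ids (believed i) t (hexagonNode j) (hexagonNode l)
    sent-view i j l sees-j sees-l t =
      cong₂ (sent A ids (believed i) t) (viewNode-sees i j sees-j) (viewNode-sees i l sees-l)

    -- The views of `i` and `j` both contain both nodes, so the two messages are the same entry in
    -- the transcripts of two corners of the box.
    sent-adjacent : ∀ i j → Hexagon.Adjacent i j → ∀ t → t < rounds A →
      sent A ids (believed j) t (hexagonNode j) (hexagonNode i) ≡
      sent A ids (believed i) t (hexagonNode j) (hexagonNode i)
    sent-adjacent i j adj t t<R =
      trans (sym (sent-view j j i (sees-self j) (sees-adjacent j (Hexagon.adjacent-sym {i} {j} adj)) t))
        (trans (transcript-sent (corner x (view j)) (corner x (view i)) (same (view j) (view i))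
                 t t<R (role j) (role i))
               (sent-view i j i (sees-adjacent i adj) (sees-self i) t))

    Agree : Fin 6 → Fin n → Set
    Agree i v = ∃ λ j → hexagonNode j ≡ v ×
      (∀ t → t < rounds A → sent A ids (believed j) t v (hexagonNode i) ≡
                            sent A ids (believed i) t v (hexagonNode i))

    agree : ∀ i v → v ∈ neighbourhood hexagon (hexagonNode i) → Agree i v
    agree i v v∈ = fromAdjacent (∈-around-node⁻ {v} {i} v∈)
      where
      fromAdjacent : (∃ λ j → hexagonNode j ≡ v × Hexagon.Adjacent i j) → Agree i v
      fromAdjacent (j , refl , adj) = j , refl , sent-adjacent i j adj

    fooled : ¬ SolvesTriangleMembershipOn (MaxDegree≤ 2) A
    -- Node `0F` believes in the triangle v₂ u₀ u₁, where correctness forces the output `true`; it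
    -- decides the same in the hexagon, where correctness then yields a triangle.
    fooled solves = hexagon-¬inTriangle hexagonNodes
      (Equivalence.to (solves hexagon hexagon-maxDegree ids (hexagonNode 0F))
        (trans (fooled-decision A ids hexagon hexagonNode believed same-neighbourhood agree 0F)
          (Equivalence.from
            (solves (believed 0F) (Cycle.cycle-maxDegree triangular (triangleNodes (corner x (view 0F))))
                   ids (hexagonNode 0F))
            (subst (InTriangle (believed 0F)) (viewNode-sees 0F 0F (sees-self 0F))
              (triangle-inTriangle (triangleNodes (corner x (view 0F))) 0F)))))

  large⇒fooled : 2 ^ (3 ^ 3 * suc (9 * rounds A)) ≤ p → ¬ SolvesTriangleMembershipOn (MaxDegree≤ 2) A
  large⇒fooled big =
    -- `(2 ^ 3) ^ 3` and `2 ^ 9` compute to the same number, so there are `2 ^ (9 * rounds A)`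
    -- colours.
    let x , x-injective , same = monochromatic-box 3 {9 * rounds A} (≤-reflexive (^-*-assoc 2 9 (rounds A))) big transcript
    in FoolingHexagon.fooled x x-injective same

-- From the exponential bound on `n` to `log*`

-- Unfold `log*` once and bound the remaining value crudely by its argument.
log*≤1+⌈log₂⌉ : ∀ n → log* n ≤ suc ⌈log₂ n ⌉
log*≤1+⌈log₂⌉ n = unfold n (<-wellFounded n)
  where
  log*-acc≤ : ∀ n rec → log*-acc n rec ≤ n
  log*-acc≤ 0             _        = z≤n
  log*-acc≤ 1             _        = z≤n
  log*-acc≤ (suc (suc n)) (acc rs) = ≤-trans (s≤s (log*-acc≤ _ _)) (⌈log₂[2+n]⌉<2+n n)

  unfold : ∀ n rec → log*-acc n rec ≤ suc ⌈log₂ n ⌉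
  unfold 0             _        = z≤n
  unfold 1             _        = z≤n
  unfold (suc (suc n)) (acc rs) = s≤s (log*-acc≤ _ _)

-- For `r = 0` the two bounds on `n` contradict each other; for positive `r` the additive constant
-- `suc a` is absorbed into `suc a * r`.
log*-linear : ∀ a b {n} r → 2 ^ a ≤ n → n < 2 ^ (a + b * r) → log* n ≤ (suc a + b) * r
log*-linear a b {n} zero    2^a≤n n<2^a =
  contradiction (subst (λ e → n < 2 ^ e) (trans (cong (a +_) (*-zeroʳ b)) (+-identityʳ a)) n<2^a) (≤⇒≯ 2^a≤n)
log*-linear a b {n} r@(suc _) _ n<2^ = begin
  log* n                        ≤⟨ log*≤1+⌈log₂⌉ n ⟩
  suc ⌈log₂ n ⌉                 ≤⟨ s≤s (⌈log₂⌉-mono-≤ (<⇒≤ n<2^)) ⟩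
  suc ⌈log₂ 2 ^ (a + b * r) ⌉   ≡⟨ cong suc (⌈log₂2^n⌉≡n (a + b * r)) ⟩
  suc a + b * r                 ≤⟨ +-monoˡ-≤ (b * r) (m≤m*n (suc a) r) ⟩
  suc a * r + b * r             ≡⟨ *-distribʳ-+ r (suc a) b ⟨
  (suc a + b) * r               ∎
  where open ≤-Reasoning

3*2^e≤2^[2+e] : ∀ e → 3 * 2 ^ e ≤ 2 ^ (2 + e)
3*2^e≤2^[2+e] e = ≤-trans (*-monoˡ-≤ (2 ^ e) (n≤1+n 3)) (≤-reflexive (sym (^-distribˡ-+-* 2 2 e)))

exponent≡ : ∀ r → 2 + 3 ^ 3 * suc (9 * r) ≡ 29 + 243 * r
exponent≡ = solve 1 (λ r → con 2 :+ con 27 :* (con 1 :+ con 9 :* r) := con 29 :+ con 243 :* r) refl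
  where open +-*-Solver

-- Take `p` to be exactly the threshold of `large⇒fooled`. A correct algorithm then forces
-- `n < 3 * p`, which is at most `4 * p`.
n<2^[29+243R] : ∀ {n N} → n ≤ N → (A : Algorithm N 1) →
  SolvesTriangleMembershipOn {n} (MaxDegree≤ 2) A → n < 2 ^ (29 + 243 * rounds A)
n<2^[29+243R] {n} n≤N A solves = subst (λ e → n < 2 ^ e) (exponent≡ (rounds A))
  (<-≤-trans (≰⇒> (λ 3p≤n → large⇒fooled A n≤N 3p≤n ≤-refl solves)) (3*2^e≤2^[2+e] (3 ^ 3 * suc (9 * rounds A))))

-- In unnormalised rationals the inequality is one between cross products of integers.
a≤dr⇒a/d≤r : ∀ d a r → a ≤ suc d * r → (ℤ.+ 1 ℚ./ suc d) ℚ.* fromℕ a ℚ.≤ fromℕ r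
a≤dr⇒a/d≤r d a r a≤dr = ℚ.toℚᵘ-cancel-≤ (begin
  ℚ.toℚᵘ ((ℤ.+ 1 ℚ./ suc d) ℚ.* fromℕ a)               ≃⟨ ℚ.toℚᵘ-homo-* (ℤ.+ 1 ℚ./ suc d) (fromℕ a) ⟩
  ℚ.toℚᵘ (ℤ.+ 1 ℚ./ suc d) ℚᵘ.* ℚ.toℚᵘ (fromℕ a)       ≃⟨ ℚᵘ.*-cong (ℚ.toℚᵘ-fromℚᵘ (mkℚᵘ (ℤ.+ 1) d)) (ℚ.toℚᵘ-fromℚᵘ (mkℚᵘ (ℤ.+ a) 0)) ⟩
  mkℚᵘ (ℤ.+ 1) d ℚᵘ.* mkℚᵘ (ℤ.+ a) 0                     ≤⟨ *≤* cross ⟩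
  mkℚᵘ (ℤ.+ r) 0                                       ≃⟨ ℚ.toℚᵘ-fromℚᵘ (mkℚᵘ (ℤ.+ r) 0) ⟨
  ℚ.toℚᵘ (fromℕ r)                                   ∎)
  where
  open ℚᵘ.≤-Reasoning
  cross : (ℤ.+ 1 ℤ.* ℤ.+ a) ℤ.* ℤ.+ 1 ℤ.≤ ℤ.+ r ℤ.* ℤ.+ (suc d * 1)
  cross = subst₂ ℤ._≤_
    (sym (trans (ℤ.*-identityʳ _) (ℤ.*-identityˡ (ℤ.+ a))))
    (trans (cong ℤ.+_ (trans (*-comm (suc d) r) (cong (r *_) (sym (*-identityʳ (suc d)))))) (ℤ.pos-* r (suc d * 1)))
    (ℤ.+≤+ a≤dr)

theorem3 : (N : ℕ → ℕ) → IsPolynomial N → (∀ n → n ≤ N n) →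
    ∃₂ λ (c : ℚ) (n₀ : ℕ) → 0ℚ ℚ.< c ×
    (∀ n → n₀ ≤ n → (A : Algorithm (N n) 1) →
    SolvesTriangleMembershipOn {n} (MaxDegree≤ 2) A →
    c ℚ.* fromℕ (log* n) ℚ.≤ fromℕ (rounds A))
-- 273 is `suc 29 + 243` from `log*-linear`; `n ≥ 2 ^ 29` excludes algorithms with zero rounds.
theorem3 N _ n≤N = ℤ.+ 1 ℚ./ 273 , 2 ^ 29 , ℚ.positive⁻¹ (ℤ.+ 1 ℚ./ 273) ,
  λ n n₀≤n A solves → a≤dr⇒a/d≤r 272 (log* n) (rounds A)
    (log*-linear 29 243 (rounds A) n₀≤n (n<2^[29+243R] (n≤N n) A solves))
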